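{- Let $T$ be a finite directed tree. Then $T$ is regularly diagonal, i.e. $\mathrm{EMH}_{k,\ell}(T)=0$ for all $k\neq\ell$.
   Context: $R$ is a fixed commutative unital ring. A directed tree is a directed graph obtained from a tree (connected acyclic undirected graph) by choosing one orientation for each edge. For a directed graph $G$, $d_G(x,y)$ is the minimal length of a directed path from $x$ to $y$ ($\infty$ if none), and $\mathrm{len}(x_0,\dots,x_k)=\sum_{i=0}^{k-1}d_G(x_i,x_{i+1})$ when all terms are finite. $\mathrm{EMC}_{k,\ell}(G)$ is the free $R$-module on tuples $(x_0,\dots,x_k)$ of pairwise distinct vertices with $d_G(x_i,x_{i+1})<\infty$ for all $i$ and length $\ell$; $\partial=\sum_{i=1}^{k-1}(-1)^i\partial_i$, where $\partial_i$ deletes $x_i$ if the resulting tuple still has length $\ell$ and is $0$ otherwise; $\mathrm{EMH}_{k,\ell}(G)=H_k(\mathrm{EMC}_{*,\ell}(G),\partial)$. -}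

module Defs where

open import Level using (Level; 0ℓ; _⊔_)
open import Algebra.Bundles using (CommutativeRing)
open import Algebra.Module.Bundles using (Module)
open import Algebra.Module.Structures.Biased using (IsModuleFromLeft)
open import Data.Fin.Base using (Fin; zero; suc; inject₁; toℕ)
open import Data.Fin.Properties using (any?) renaming (_≟_ to _≟ᶠ_)
open import Data.Irrelevant as Irrelevant using ()
open import Data.List.Base as List using (List; []; _∷_; _++_; _∷ʳ_; concatMap; allFin)
open import Data.List.Properties using (++-assoc; ++-identityʳ; map-++; concatMap-++)
open import Data.List.Relation.Unary.Linked using (Linked)
import Data.List.Relation.Unary.Unique.Propositional as List
open import Data.Nat.Base using (ℕ; zero; suc; _+_; _∸_; _≤_; s≤s; NonZero)
open import Data.Nat.Properties using (_≟_; anyUpTo?; m≤m+n; m+n∸m≡n; m+[n∸m]≡n; ≮⇒≥; <⇒≱)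
open import Data.Product.Base using (Σ; Σ-syntax; ∃-syntax; _×_; _,_)
open import Data.Refinement as Refinement using (Refinement-syntax; _,_)
open import Data.Sum.Base using (_⊎_)
open import Data.Unit.Polymorphic.Base using (⊤; tt)
open import Data.Vec.Base using (Vec; []; _∷_; removeAt)
open import Data.Vec.Properties using (≡-dec)
open import Data.Vec.Relation.Unary.All using (All; []; _∷_)
open import Data.Vec.Relation.Unary.AllPairs using ([]; _∷_)
open import Data.Vec.Relation.Unary.Unique.Propositional using (Unique)
open import Relation.Binary.Bundles using (Setoid)
open import Relation.Binary.Core using (Rel)
open import Relation.Binary.Construct.Closure.ReflexiveTransitive using (Star)
open import Relation.Binary.Definitions
  using (Decidable; DecidableEquality; Irreflexive; Symmetric)
open import Relation.Binary.PropositionalEquality.Core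
  using (_≡_; _≢_; refl; sym; cong; subst)
import Relation.Binary.Reasoning.Setoid as SetoidReasoning
open import Relation.Nullary.Decidable.Core using (Dec; yes; no; map′; _×-dec_; ¬?)
open import Relation.Nullary.Negation.Core using (¬_)

private
  variable
    a : Level
    A B : Set a
    n k ℓ : ℕ

------------------------------------------------------------------------
-- Trees and their orientations

record Graph (n : ℕ) : Set₁ where
  infix 4 _~_
  field
    _~_         : Rel (Fin n) 0ℓ
    symmetric   : Symmetric _~_
    irreflexive : Irreflexive _≡_ _~_

-- The cycle x, xs₀, …, xsₘ, x; at least three distinct vertices.
record Cycle (G : Graph n) : Set where
  open Graph G
  field
    x        : Fin n
    xs       : List (Fin n)
    proper   : 2 ≤ List.length xs
    distinct : List.Unique (x ∷ xs)
    closed   : Linked _~_ (x ∷ (xs ∷ʳ x))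

record IsTree (G : Graph n) : Set where
  open Graph G
  field
    nonempty  : NonZero n
    connected : ∀ x y → Star _~_ x y
    acyclic   : ¬ Cycle G

-- Decidability of the edge relation costs nothing classically; it is what
-- makes the case distinction in the differential below computable.
record Digraph (n : ℕ) : Set₁ where
  infix 4 _⟶_ _⟶?_
  field
    _⟶_  : Rel (Fin n) 0ℓ
    _⟶?_ : Decidable _⟶_

record IsOrientation (G : Graph n) (D : Digraph n) : Set where
  open Graph G
  open Digraph D
  field
    ⟶⇒~    : ∀ {x y} → x ⟶ y → x ~ y
    ~⇒⟶    : ∀ {x y} → x ~ y → x ⟶ y ⊎ y ⟶ x
    oneWay : ∀ {x y} → x ⟶ y → ¬ (y ⟶ x)

IsDirectedTree : Digraph n → Set₁
IsDirectedTree {n} D = Σ[ G ∈ Graph n ] IsTree G × IsOrientation G D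

------------------------------------------------------------------------
-- Distance and length

module _ (D : Digraph n) where
  open Digraph D

  -- Vertices may repeat along a path; this does not affect minimal lengths.
  data Path : ℕ → Rel (Fin n) 0ℓ where
    []  : ∀ {x} → Path 0 x x
    _∷_ : ∀ {l x y z} → x ⟶ y → Path l y z → Path (suc l) x z

  -- Distance x y d says that d(x , y) = d; d(x , y) = ∞ when no d qualifies.
  Distance : Fin n → Fin n → ℕ → Set
  Distance x y d = Path d x y × (∀ {l} → Path l x y → d ≤ l)

  -- HasLength xs ℓ says that all consecutive distances in xs are finite and
  -- that they add up to ℓ.
  data HasLength : Vec (Fin n) (suc k) → ℕ → Set where
    [-] : ∀ {x} → HasLength (x ∷ []) 0
    _∷_ : ∀ {d m x y} {ys : Vec (Fin n) k} →
          Distance x y d → HasLength (y ∷ ys) m → HasLength (x ∷ y ∷ ys) (d + m)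

  path? : ∀ l → Decidable (Path l)
  path? zero    x y = map′ (λ where refl → []) (λ where [] → refl) (x ≟ᶠ y)
  path? (suc l) x z =
    map′ (λ (y , e , p) → e ∷ p) (λ where (_∷_ {y = y} e p) → y , e , p)
         (any? λ y → (x ⟶? y) ×-dec path? l y z)

  distance? : ∀ x y d → Dec (Distance x y d)
  distance? x y d =
    map′ (λ (p , ¬q) → p , λ q → ≮⇒≥ λ l<d → ¬q (_ , l<d , q))
         (λ (p , min) → p , λ (_ , l<d , q) → <⇒≱ l<d (min q))
         (path? d x y ×-dec ¬? (anyUpTo? (λ l → path? l x y) d))

  hasLength? : (xs : Vec (Fin n) (suc k)) → ∀ ℓ → Dec (HasLength xs ℓ)
  hasLength? (x ∷ [])     ℓ = map′ (λ where refl → [-]) (λ where [-] → refl) (ℓ ≟ 0)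
  hasLength? (x ∷ y ∷ ys) ℓ =
    map′ (λ where (d , s≤s d≤ℓ , δ , λ′) →
                    subst (HasLength (x ∷ y ∷ ys)) (m+[n∸m]≡n d≤ℓ) (δ ∷ λ′))
         (λ where (_∷_ {d = d} {m = m} δ λ′) →
                    d , s≤s (m≤m+n d m) , δ ,
                    subst (HasLength (y ∷ ys)) (sym (m+n∸m≡n d m)) λ′)
         (anyUpTo? (λ d → distance? x y d ×-dec hasLength? (y ∷ ys) (ℓ ∸ d)) (suc ℓ))

  -- The basis of EMC_{k,ℓ}; the proof component is irrelevant, so two
  -- generators are equal as soon as the tuples are.
  Generator : ℕ → ℕ → Set
  Generator k ℓ = [ xs ∈ Vec (Fin n) (suc k) ∣ Unique xs × HasLength xs ℓ ]

_≟ᵍ_ : {D : Digraph n} → DecidableEquality (Generator D k ℓ)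
_≟ᵍ_ = Refinement._≟_ (≡-dec _≟ᶠ_)

removeAt-All : ∀ {p} {P : A → Set p} {xs : Vec A (suc n)} →
               All P xs → ∀ i → All P (removeAt xs i)
removeAt-All (_ ∷ ps)            zero    = ps
removeAt-All (p ∷ ps@(_ ∷ _))    (suc i) = p ∷ removeAt-All ps i

removeAt-Unique : {xs : Vec A (suc n)} → Unique xs → ∀ i → Unique (removeAt xs i)
removeAt-Unique (_ ∷ us)         zero    = us
removeAt-Unique (p ∷ us@(_ ∷ _)) (suc i) = removeAt-All p i ∷ removeAt-Unique us i

------------------------------------------------------------------------
-- Free modules: finite formal sums Σ rᵢ aᵢ, identified when every basis
-- element has the same total coefficient.

module FreeModule {c r} (R : CommutativeRing c r) where
  open CommutativeRing R
    using (Carrier; _≈_; 0#; 1#; -_; _*_; setoid)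
    renaming (_+_ to _⊕_)
  private module R = CommutativeRing R
  open import Algebra.Properties.Ring R.ring using (-1*x≈-x)
  open SetoidReasoning setoid

  FormalSum : Set a → Set (a ⊔ c)
  FormalSum A = List (Carrier × A)

  scale : Carrier → FormalSum A → FormalSum A
  scale s = List.map λ (t , x) → (s * t , x)

  -- The R-linear extension of a map defined on the basis.
  extend : (A → FormalSum B) → FormalSum A → FormalSum B
  extend f = concatMap λ (s , x) → scale s (f x)

  module _ {A : Set a} (_≟ᴬ_ : DecidableEquality A) where

    coefficient : A → FormalSum A → Carrier
    coefficient x []            = 0#
    coefficient x ((s , y) ∷ u) with x ≟ᴬ y
    ... | yes _ = s ⊕ coefficient x u
    ... | no  _ = coefficient x u

    infix 4 _≋_
    record _≋_ (u v : FormalSum A) : Set (a ⊔ r) where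
      constructor ⟨_⟩
      field
        at : ∀ x → coefficient x u ≈ coefficient x v
    open _≋_ public

    ≡⇒≋ : ∀ {u v} → u ≡ v → u ≋ v
    ≡⇒≋ u≡v .at x = R.reflexive (cong (coefficient x) u≡v)

    coefficient-++ : ∀ x u v →
      coefficient x (u ++ v) ≈ coefficient x u ⊕ coefficient x v
    coefficient-++ x []            v = R.sym (R.+-identityˡ _)
    coefficient-++ x ((s , y) ∷ u) v with x ≟ᴬ y
    ... | yes _ = R.trans (R.+-congˡ (coefficient-++ x u v)) (R.sym (R.+-assoc _ _ _))
    ... | no  _ = coefficient-++ x u v

    coefficient-scale : ∀ x s u → coefficient x (scale s u) ≈ s * coefficient x u
    coefficient-scale x s []            = R.sym (R.zeroʳ s)
    coefficient-scale x s ((t , y) ∷ u) with x ≟ᴬ y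
    ... | yes _ = R.trans (R.+-congˡ (coefficient-scale x s u)) (R.sym (R.distribˡ _ _ _))
    ... | no  _ = coefficient-scale x s u

    coefficient-negate : ∀ x u → coefficient x (scale (- 1#) u) ≈ - coefficient x u
    coefficient-negate x u = R.trans (coefficient-scale x (- 1#) u) (-1*x≈-x _)

    scale-cong : ∀ {s t u v} → s ≈ t → u ≋ v → scale s u ≋ scale t v
    scale-cong {s} {t} {u} {v} s≈t u≋v .at x = begin
      coefficient x (scale s u) ≈⟨ coefficient-scale x s u ⟩
      s * coefficient x u       ≈⟨ R.*-cong s≈t (at u≋v x) ⟩
      t * coefficient x v       ≈⟨ coefficient-scale x t v ⟨
      coefficient x (scale t v) ∎

    ++-cong : ∀ {t u v w} → t ≋ u → v ≋ w → t ++ v ≋ u ++ w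
    ++-cong {t} {u} {v} {w} t≋u v≋w .at x = begin
      coefficient x (t ++ v)              ≈⟨ coefficient-++ x t v ⟩
      coefficient x t ⊕ coefficient x v   ≈⟨ R.+-cong (at t≋u x) (at v≋w x) ⟩
      coefficient x u ⊕ coefficient x w   ≈⟨ coefficient-++ x u w ⟨
      coefficient x (u ++ w)              ∎

    ++-comm : ∀ u v → u ++ v ≋ v ++ u
    ++-comm u v .at x = begin
      coefficient x (u ++ v)             ≈⟨ coefficient-++ x u v ⟩
      coefficient x u ⊕ coefficient x v  ≈⟨ R.+-comm _ _ ⟩
      coefficient x v ⊕ coefficient x u  ≈⟨ coefficient-++ x v u ⟨
      coefficient x (v ++ u)             ∎

    scale-distribʳ : ∀ u s t → scale (s ⊕ t) u ≋ scale s u ++ scale t u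
    scale-distribʳ u s t .at x = begin
      coefficient x (scale (s ⊕ t) u)                          ≈⟨ coefficient-scale x (s ⊕ t) u ⟩
      (s ⊕ t) * coefficient x u                                ≈⟨ R.distribʳ _ s t ⟩
      s * coefficient x u ⊕ t * coefficient x u                ≈⟨ R.+-cong (coefficient-scale x s u) (coefficient-scale x t u) ⟨
      coefficient x (scale s u) ⊕ coefficient x (scale t u)    ≈⟨ coefficient-++ x (scale s u) (scale t u) ⟨
      coefficient x (scale s u ++ scale t u)                   ∎

    scale-assoc : ∀ s t u → scale (s * t) u ≋ scale s (scale t u)
    scale-assoc s t u .at x = begin
      coefficient x (scale (s * t) u)       ≈⟨ coefficient-scale x (s * t) u ⟩
      s * t * coefficient x u               ≈⟨ R.*-assoc s t _ ⟩
      s * (t * coefficient x u)             ≈⟨ R.*-congˡ (coefficient-scale x t u) ⟨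
      s * coefficient x (scale t u)         ≈⟨ coefficient-scale x s (scale t u) ⟨
      coefficient x (scale s (scale t u))   ∎

    ++-inverseʳ : ∀ u → u ++ scale (- 1#) u ≋ []
    ++-inverseʳ u .at x = begin
      coefficient x (u ++ scale (- 1#) u)               ≈⟨ coefficient-++ x u _ ⟩
      coefficient x u ⊕ coefficient x (scale (- 1#) u)  ≈⟨ R.+-congˡ (coefficient-negate x u) ⟩
      coefficient x u ⊕ - coefficient x u               ≈⟨ R.-‿inverseʳ _ ⟩
      0#                                                ∎

    ++-inverseˡ : ∀ u → scale (- 1#) u ++ u ≋ []
    ++-inverseˡ u .at x =
      R.trans (at (++-comm (scale (- 1#) u) u) x) (at (++-inverseʳ u) x)

    freeModule : Module R (a ⊔ c) (a ⊔ r)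
    freeModule = record
      { Carrierᴹ = FormalSum A
      ; _≈ᴹ_     = _≋_
      ; _+ᴹ_     = _++_
      ; _*ₗ_     = scale
      ; _*ᵣ_     = λ u s → scale s u
      ; 0ᴹ       = []
      ; -ᴹ_      = scale (- 1#)
      ; isModule = IsModuleFromLeft.isModule {commutativeRing = R} record
        { isLeftModule = record
          { isLeftSemimodule = record
            { +ᴹ-isCommutativeMonoid = record
              { isMonoid = record
                { isSemigroup = record
                  { isMagma = record
                    { isEquivalence = record
                      { refl  = ⟨ (λ _ → R.refl) ⟩
                      ; sym   = λ u≋v → ⟨ (λ x → R.sym (at u≋v x)) ⟩
                      ; trans = λ u≋v v≋w → ⟨ (λ x → R.trans (at u≋v x) (at v≋w x)) ⟩
                      }
                    ; ∙-cong = ++-cong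
                    }
                  ; assoc = λ u v w → ≡⇒≋ (++-assoc u v w)
                  }
                ; identity = (λ _ → ≡⇒≋ refl) , (λ u → ≡⇒≋ (++-identityʳ u))
                }
              ; comm = ++-comm
              }
            ; isPreleftSemimodule = record
              { *ₗ-cong      = scale-cong
              ; *ₗ-zeroˡ     = λ u → ⟨ (λ x → R.trans (coefficient-scale x 0# u) (R.zeroˡ _)) ⟩
              ; *ₗ-distribʳ  = scale-distribʳ
              ; *ₗ-identityˡ = λ u → ⟨ (λ x → R.trans (coefficient-scale x 1# u) (R.*-identityˡ _)) ⟩
              ; *ₗ-assoc     = scale-assoc
              ; *ₗ-zeroʳ     = λ _ → ≡⇒≋ refl
              ; *ₗ-distribˡ  = λ s u v → ≡⇒≋ (map-++ _ u v)
              }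
            }
          ; -ᴹ‿cong    = scale-cong R.refl
          ; -ᴹ‿inverse = ++-inverseˡ , ++-inverseʳ
          }
        }
      }

  module _ (_≟ᴮ_ : DecidableEquality B) where
    open Module (freeModule _≟ᴮ_)

    extend-++ : ∀ (f : A → FormalSum B) u v →
                extend f (u ++ v) ≈ᴹ extend f u +ᴹ extend f v
    extend-++ f u v = ≈ᴹ-reflexive (concatMap-++ _ u v)

    extend-scale : ∀ (f : A → FormalSum B) s u →
                   extend f (scale s u) ≈ᴹ s *ₗ extend f u
    extend-scale f s []            = ≈ᴹ-refl
    extend-scale f s ((t , x) ∷ u) = ≈ᴹ-trans
      (+ᴹ-cong (*ₗ-assoc s t (f x)) (extend-scale f s u))
      (≈ᴹ-sym (*ₗ-distribˡ s (t *ₗ f x) (extend f u)))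

------------------------------------------------------------------------
-- The Eulerian magnitude complex and its homology

module _ {c r} (R : CommutativeRing c r) (D : Digraph n) where
  open CommutativeRing R using (1#; -_; semiring)
  open import Algebra.Properties.Semiring.Exp semiring using (_^_)
  open FreeModule R

  EMC : ℕ → ℕ → Module R c r
  EMC k ℓ = freeModule (_≟ᵍ_ {k = k} {ℓ} {D})

  -- The entries x₁, …, xₖ of a tuple (x₀, …, xₖ₊₁).
  interior : Fin k → Fin (suc (suc k))
  interior i = suc (inject₁ i)

  delete : Fin k → Generator D (suc k) ℓ → FormalSum (Generator D k ℓ)
  delete {ℓ = ℓ} i (xs , p) with hasLength? D (removeAt xs (interior i)) ℓ
  ... | yes q = (1# , removeAt xs (interior i) ,
                      Irrelevant.map (λ (u , _) → removeAt-Unique u (interior i) , q) p) ∷ []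
  ... | no  _ = []

  ∂ : FormalSum (Generator D (suc k) ℓ) → FormalSum (Generator D k ℓ)
  ∂ {k} = extend λ g →
    concatMap (λ i → scale ((- 1#) ^ toℕ (interior i)) (delete i g)) (allFin k)

  -- The complex is zero in negative degrees, so every 0-chain is a cycle.
  IsCycle : ∀ k ℓ → FormalSum (Generator D k ℓ) → Set r
  IsCycle zero    ℓ z = ⊤
  IsCycle (suc k) ℓ z = ∂ z ≈ᴹ 0ᴹ
    where open Module (EMC k ℓ)

  -- ker ∂ / im ∂: cycles, identified when they differ by a boundary.
  EMH : ℕ → ℕ → Setoid (c ⊔ r) (c ⊔ r)
  EMH k ℓ = record
    { Carrier       = Σ Carrierᴹ (IsCycle k ℓ)
    ; _≈_           = λ (z , _) (w , _) → ∃[ b ] ∂ b ≈ᴹ z +ᴹ -ᴹ w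
    ; isEquivalence = record
      { refl  = λ { {z , _} → [] , ≈ᴹ-sym (-ᴹ‿inverseʳ z) }
      ; sym   = λ { {z , _} {w , _} (b , ∂b≈z-w) → scale (- 1#) b , (begin
          ∂ (scale (- 1#) b)  ≈⟨ extend-scale _≟ᵍ_ _ (- 1#) b ⟩
          -ᴹ (∂ b)            ≈⟨ -ᴹ‿cong ∂b≈z-w ⟩
          -ᴹ (z +ᴹ -ᴹ w)      ≈⟨ ⁻¹-anti-homo‿- z w ⟩
          w +ᴹ -ᴹ z           ∎) }
      ; trans = λ { {z , _} {w , _} {v , _} (b , ∂b≈z-w) (b′ , ∂b′≈w-v) → b ++ b′ , (begin
          ∂ (b ++ b′)                        ≈⟨ extend-++ _≟ᵍ_ _ b b′ ⟩
          ∂ b +ᴹ ∂ b′                        ≈⟨ +ᴹ-cong ∂b≈z-w ∂b′≈w-v ⟩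
          (z +ᴹ -ᴹ w) +ᴹ (w +ᴹ -ᴹ v)         ≈⟨ +ᴹ-assoc (z +ᴹ -ᴹ w) w (-ᴹ v) ⟨
          ((z +ᴹ -ᴹ w) +ᴹ w) +ᴹ -ᴹ v         ≈⟨ +ᴹ-congʳ (//-rightDividesˡ w z) ⟩
          z +ᴹ -ᴹ v                          ∎) }
      }
    }
    where
    open Module (EMC k ℓ)
    open import Algebra.Properties.AbelianGroup +ᴹ-abelianGroup
      using (⁻¹-anti-homo‿-; //-rightDividesˡ)
    open SetoidReasoning ≈ᴹ-setoid

  0ᴴ : ∀ k ℓ → Setoid.Carrier (EMH k ℓ)
  0ᴴ zero    ℓ = [] , tt
  0ᴴ (suc k) ℓ = [] , Module.≈ᴹ-refl (EMC k ℓ)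

  EMH-vanishes : ℕ → ℕ → Set (c ⊔ r)
  EMH-vanishes k ℓ = ∀ z → z ≈ 0ᴴ k ℓ
    where open Setoid (EMH k ℓ)

  RegularlyDiagonal : Set (c ⊔ r)
  RegularlyDiagonal = ∀ k ℓ → k ≢ ℓ → EMH-vanishes k ℓ

{-# OPTIONS --safe #-}
module Submission where

-- In an acyclic graph every nonbacktracking walk has distinct vertices.  An
-- orientation forbids backtracking along directed paths, so directed paths in a
-- directed tree are unique: all of them realise the distance, lengths add up along
-- directed paths, and every interior vertex of a generator can be deleted without
-- changing the length.  Hence ∂ preserves x₀ and xₖ.  Let v be the first vertex after
-- x₀ on the path to xₖ.  The map (x₀, x₁, …, xₖ) ↦ - (x₀, v, x₁, …, xₖ) if x₁ ≠ v, and
-- 0 if x₁ = v, is a contracting homotopy.  It fails only at a single edge (x₀, v),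
-- where v is not interior, and there k = ℓ = 1; for k = 0 there is nothing unless ℓ = 0.

open import Defs
open import Algebra.Bundles using (CommutativeMonoid; CommutativeRing)
open import Algebra.Module.Bundles using (Module)
import Algebra.Properties.CommutativeSemigroup as CommutativeSemigroupProperties
import Algebra.Properties.Ring as RingProperties
import Algebra.Properties.Semiring.Exp as Exp
open import Data.Empty using (⊥; ⊥-elim-irr)
open import Data.Fin.Base using (Fin; zero; suc; toℕ; inject₁)
open import Data.Fin.Properties using (any?) renaming (_≟_ to _≟ᶠ_)
open import Data.Irrelevant as Irrelevant using ([_])
open import Data.List.Base as List
  using (List; []; _∷_; _++_; _∷ʳ_; concatMap; allFin; tabulate; filter; length)
open import Data.List.Membership.Propositional using (_∈_; _∉_)
open import Data.List.Membership.Propositional.Properties using (∈-∃++)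
open import Data.List.Properties
  using (++-assoc; ++-identityʳ; ∷ʳ-++; concatMap-++; concatMap-map; map-concatMap; map-tabulate;
         length-filter)
open import Data.List.Relation.Binary.Permutation.Propositional using (↭⇒↭ₛ)
open import Data.List.Relation.Binary.Permutation.Propositional.Properties using (shift)
open import Data.List.Relation.Binary.Permutation.Setoid.Properties using (Unique-resp-↭)
open import Data.List.Relation.Unary.All.Properties using (¬Any⇒All¬; All¬⇒¬Any; ++⁻ˡ)
open import Data.List.Relation.Unary.Any using (here; there)
open import Data.List.Relation.Unary.Linked using (Linked; []; [-]; _∷_)
import Data.List.Relation.Unary.AllPairs as AllPairs
import Data.List.Relation.Unary.All as All
import Data.List.Relation.Unary.Unique.Propositional as ListUnique
open import Data.Nat.Base using (ℕ; zero; suc; _+_; _≤_; z≤n; s≤s)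
open import Data.Nat.Properties using (≤-refl; ≤-reflexive; ≤-trans; +-assoc)
open import Data.Product.Base using (∃-syntax; _×_; _,_; proj₁; proj₂)
open import Data.Refinement using (_,_; proof)
open import Data.Vec.Base as Vec using (Vec; []; _∷_; removeAt)
open import Data.Vec.Relation.Unary.All as VecAll using ([]; _∷_)
open import Data.Vec.Relation.Unary.AllPairs using ([]; _∷_)
open import Data.Vec.Relation.Unary.Unique.Propositional using (Unique)
open import Function.Base using (_∘_; id)
open import Relation.Binary.Core using (Rel)
open import Relation.Binary.Definitions using (DecidableEquality)
open import Relation.Binary.PropositionalEquality
  using (_≡_; _≢_; refl; sym; trans; cong; cong₂; subst; setoid; module ≡-Reasoning)
import Relation.Binary.Reasoning.Setoid as SetoidReasoning
open import Relation.Nullary.Decidable.Core using (yes; no; _×-dec_; ¬?; recompute)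
open import Relation.Nullary.Negation.Core using (¬_; contradiction)

-- Walks in forests

Linked-++⁻ˡ : ∀ {a r} {A : Set a} {R : Rel A r} xs {ys} → Linked R (xs ++ ys) → Linked R xs
Linked-++⁻ˡ []           _        = []
Linked-++⁻ˡ (_ ∷ [])     _        = [-]
Linked-++⁻ˡ (_ ∷ _ ∷ xs) (e ∷ es) = e ∷ Linked-++⁻ˡ (_ ∷ xs) es

Unique-++⁻ˡ : ∀ {a} {A : Set a} (xs : List A) {ys} → ListUnique.Unique (xs ++ ys) → ListUnique.Unique xs
Unique-++⁻ˡ []       _                    = AllPairs.[]
Unique-++⁻ˡ (_ ∷ xs) (x∉ AllPairs.∷ uniq) = ++⁻ˡ xs x∉ AllPairs.∷ Unique-++⁻ˡ xs uniq

module _ {n} (G : Graph n) where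
  open Graph G

  infixr 5 _∷⟨_⟩_
  data NonBacktracking : List (Fin n) → Set where
    [-]     : ∀ {x} → NonBacktracking (x ∷ [])
    edge    : ∀ {x y} → x ~ y → NonBacktracking (x ∷ y ∷ [])
    _∷⟨_⟩_  : ∀ {x y z zs} → x ~ y → x ≢ z → NonBacktracking (y ∷ z ∷ zs) →
              NonBacktracking (x ∷ y ∷ z ∷ zs)

  NonBacktracking⇒Linked : ∀ {xs} → NonBacktracking xs → Linked _~_ xs
  NonBacktracking⇒Linked [-]          = [-]
  NonBacktracking⇒Linked (edge e)     = e ∷ [-]
  NonBacktracking⇒Linked (e ∷⟨ _ ⟩ es) = e ∷ NonBacktracking⇒Linked es

  -- By induction the tail has no repetition. If the head recurs, the walk up to its first return
  -- closes up: that stretch cannot be empty (a loop) or a single vertex (backtracking), so it is a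
  -- cycle.
  NonBacktracking⇒Unique : ¬ Cycle G → ∀ {xs} → NonBacktracking xs → ListUnique.Unique xs
  NonBacktracking⇒Unique _ [-]      = All.[] AllPairs.∷ AllPairs.[]
  NonBacktracking⇒Unique _ (edge e) =
    ((λ x≡y → irreflexive x≡y e) All.∷ All.[]) AllPairs.∷ All.[] AllPairs.∷ AllPairs.[]
  NonBacktracking⇒Unique acyclic walk@(_∷⟨_⟩_ {x} {y} {z} {zs} e x≢z es) =
    ¬Any⇒All¬ _ x∉ AllPairs.∷ uniq
    where
    uniq : ListUnique.Unique (y ∷ z ∷ zs)
    uniq = NonBacktracking⇒Unique acyclic es

    closes : ∀ ps {qs} → y ∷ z ∷ zs ≡ ps ++ x ∷ qs → ⊥
    closes []                  refl = irreflexive refl e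
    closes (_ ∷ [])            refl = x≢z refl
    closes ps@(_ ∷ _ ∷ _) {qs} eq   = acyclic record
      { x        = x
      ; xs       = ps
      ; proper   = s≤s (s≤s z≤n)
      -- Distinctness is known for `ps ++ x ∷ qs`; moving the recurring `x` to the front and cutting
      -- off `qs` gives it for `x ∷ ps`.
      ; distinct = Unique-++⁻ˡ (x ∷ ps)
          (Unique-resp-↭ (setoid _) (↭⇒↭ₛ (shift x ps qs)) (subst ListUnique.Unique eq uniq))
      ; closed   = Linked-++⁻ˡ (x ∷ (ps ∷ʳ x))
          (subst (Linked _~_ ∘ (x ∷_)) (trans eq (sym (∷ʳ-++ ps x qs)))
            (NonBacktracking⇒Linked walk))
      }

    x∉ : x ∉ y ∷ z ∷ zs
    x∉ x∈ with ps , _ , eq ← ∈-∃++ x∈ = closes ps eq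

-- Distances in directed trees

Path-++ : ∀ {n} {D : Digraph n} {l m x y z} → Path D l x y → Path D m y z → Path D (l + m) x z
Path-++ []      q = q
Path-++ (e ∷ p) q = e ∷ Path-++ p q

HasLength⇒reachable : ∀ {n} {D : Digraph n} {k ℓ x} {xs : Vec (Fin n) k} → HasLength D (x ∷ xs) ℓ →
                      VecAll.All (λ z → ∃[ l ] Path D l x z) (x ∷ xs)
HasLength⇒reachable [-]             = (_ , []) ∷ []
HasLength⇒reachable ((p , _) ∷ len) =
  (_ , []) ∷ VecAll.map (λ (_ , q) → _ , Path-++ p q) (HasLength⇒reachable len)

second-path : ∀ {n} {D : Digraph n} {k ℓ x y} {xs : Vec (Fin n) (suc k)} →
              HasLength D (x ∷ y ∷ xs) ℓ → ∃[ l ] Path D l y (Vec.head xs)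
second-path {xs = _ ∷ _} (_ ∷ (p , _) ∷ _) = _ , p

module _ {n} {D : Digraph n} (T : IsDirectedTree D) where
  open Digraph D
  private
    G = proj₁ T
  open Graph G using (_~_; symmetric; irreflexive)
  open IsTree (proj₁ (proj₂ T)) using (acyclic)
  open IsOrientation (proj₂ (proj₂ T))

  ⟶⟶-≢ : ∀ {x y z} → x ⟶ y → y ⟶ z → x ≢ z
  ⟶⟶-≢ e f refl = oneWay e f

  -- By `oneWay`, two consecutive arrows never reverse each other. The first arrow is kept explicit
  -- so that the walk can be extended at `x`, and so that `y` is known to occur after the head.
  Path⇒NonBacktracking : ∀ {l x v y} → x ⟶ v → Path D l v y →
                         ∃[ ws ] NonBacktracking G (x ∷ v ∷ ws) × y ∈ v ∷ ws
  Path⇒NonBacktracking e []      = [] , edge (⟶⇒~ e) , here refl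
  Path⇒NonBacktracking e (f ∷ p) with ws , walk , y∈ ← Path⇒NonBacktracking f p =
    _ , (⟶⇒~ e ∷⟨ ⟶⟶-≢ e f ⟩ walk) , there y∈

  -- Otherwise, prepending the reversed path gives a nonbacktracking walk visiting y twice.
  no-return : ∀ {l w v y ws} → w ⟶ v → Path D l v y → NonBacktracking G (v ∷ w ∷ ws) → y ∉ w ∷ ws
  no-return e []      walk = All¬⇒¬Any (AllPairs.head (NonBacktracking⇒Unique G acyclic walk))
  no-return e (f ∷ p) walk =
    no-return f p (symmetric (⟶⇒~ f) ∷⟨ (λ u≡w → ⟶⟶-≢ e f (sym u≡w)) ⟩ walk) ∘ there

  no-closed-path : ∀ {l x v} → x ⟶ v → ¬ Path D l v x
  no-closed-path e p with _ , walk , x∈ ← Path⇒NonBacktracking e p =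
    All¬⇒¬Any (AllPairs.head (NonBacktracking⇒Unique G acyclic walk)) x∈

  -- If `v ≢ w`, reversing `x ⟶ v` and then following the second path gives a nonbacktracking walk
  -- from `v` through `x` and `w` to `y`. By `no-return` the first path cannot end on it.
  successor-unique : ∀ {l m x v w y} → x ⟶ v → Path D l v y → x ⟶ w → Path D m w y → v ≡ w
  successor-unique {v = v} {w} e p f q with v ≟ᶠ w
  ... | yes v≡w = v≡w
  ... | no  v≢w with _ , walk , y∈ ← Path⇒NonBacktracking f q =
    contradiction (there y∈) (no-return e p (symmetric (⟶⇒~ e) ∷⟨ v≢w ⟩ walk))

  Path-length-unique : ∀ {l m x y} → Path D l x y → Path D m x y → l ≡ m
  Path-length-unique []      []      = refl
  Path-length-unique []      (f ∷ q) = contradiction q (no-closed-path f)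
  Path-length-unique (e ∷ p) []      = contradiction p (no-closed-path e)
  Path-length-unique (e ∷ p) (f ∷ q) with refl ← successor-unique e p f q =
    cong suc (Path-length-unique p q)

  Path⇒Distance : ∀ {l x y} → Path D l x y → Distance D x y l
  Path⇒Distance p = p , λ q → ≤-reflexive (Path-length-unique p q)

  -- The two paths around the deleted vertex concatenate to a path, which again realises the
  -- distance, so the triangle inequality is an equality.
  HasLength-removeAt : ∀ {k ℓ} {xs : Vec (Fin n) (suc (suc k))} → HasLength D xs ℓ →
                       ∀ i → HasLength D (removeAt xs (suc (inject₁ i))) ℓ
  HasLength-removeAt (_∷_ {d = d} (p , _) (_∷_ {d = d′} {m = m} (q , _) len)) zero =
    subst (HasLength D _) (+-assoc d d′ m) (Path⇒Distance (Path-++ p q) ∷ len)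
  HasLength-removeAt (_∷_ {ys = _ ∷ _} δ len) (suc i) = δ ∷ HasLength-removeAt len i

  -- Every later entry is reachable from `v` through `y`. As `v ≢ y`, the path from `v` to `y` is
  -- nonempty, so a later occurrence of `v` would close a directed path.
  Unique-insert : ∀ {k m x v} {xs : Vec (Fin n) (suc k)} → x ⟶ v → v ≢ Vec.head xs →
                  HasLength D (x ∷ v ∷ xs) m → Unique (x ∷ xs) → Unique (x ∷ v ∷ xs)
  Unique-insert {xs = y ∷ _} e v≢y (_ ∷ (p , _) ∷ len) (x∉ ∷ uniq) =
    ((λ x≡v → irreflexive x≡v (⟶⇒~ e)) ∷ x∉) ∷
    VecAll.map (λ (_ , q) → v≢ p q) (HasLength⇒reachable len) ∷ uniq
    where
    v≢ : ∀ {l m z} → Path D l _ y → Path D m y z → _ ≢ z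
    v≢ []      q refl = v≢y refl
    v≢ (f ∷ p) q refl = no-closed-path f (Path-++ p q)

  face : ∀ {k ℓ} → Fin k → Generator D (suc k) ℓ → Generator D k ℓ
  face i (xs , p) = removeAt xs (suc (inject₁ i)) ,
    Irrelevant.map (λ (uniq , len) → removeAt-Unique uniq _ , HasLength-removeAt len i) p

-- Formal sums

concatMap-[] : ∀ {a b} {A : Set a} {B : Set b} {f : A → List B} → (∀ x → f x ≡ []) →
               ∀ xs → concatMap f xs ≡ []
concatMap-[] f≡[] []       = refl
concatMap-[] f≡[] (x ∷ xs) = cong₂ _++_ (f≡[] x) (concatMap-[] f≡[] xs)

concatMap-allFin-suc : ∀ {b} {B : Set b} k (f : Fin (suc k) → List B) →
                       concatMap f (allFin (suc k)) ≡ f zero ++ concatMap (f ∘ suc) (allFin k)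
concatMap-allFin-suc k f = cong (f zero ++_) (begin
  concatMap f (tabulate suc)               ≡⟨ cong (concatMap f) (map-tabulate id suc) ⟨
  concatMap f (List.map suc (allFin k)) ≡⟨ concatMap-map f suc (allFin k) ⟩
  concatMap (f ∘ suc) (allFin k)           ∎)
  where open ≡-Reasoning

module FormalSums {c r} (R : CommutativeRing c r) where
  open CommutativeRing R
    using (Carrier; _≈_; 0#; 1#; -_; _*_)
    renaming (_+_ to _⊕_)
  private module R = CommutativeRing R
  open RingProperties R.ring using (-1*x≈-x; -‿involutive)
  open FreeModule R

  -1*-1≈1 : - 1# * - 1# ≈ 1#
  -1*-1≈1 = R.trans (-1*x≈-x _) (-‿involutive _)

  extend-concatMap : ∀ {a b i} {A : Set a} {B : Set b} {I : Set i}
                     (f : A → FormalSum B) (g : I → FormalSum A) is →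
                     extend f (concatMap g is) ≡ concatMap (extend f ∘ g) is
  extend-concatMap f g []       = refl
  extend-concatMap f g (i ∷ is) =
    trans (concatMap-++ _ (g i) _) (cong (extend f (g i) ++_) (extend-concatMap f g is))

  module _ {a} {A : Set a} (_≟ᴬ_ : DecidableEquality A) where
    open Module (freeModule _≟ᴬ_)
    open SetoidReasoning ≈ᴹ-setoid
    open CommutativeSemigroupProperties
      (CommutativeMonoid.commutativeSemigroup +ᴹ-commutativeMonoid) using (interchange)

    singleton-cong : ∀ {s t x} → s ≈ t → (s , x) ∷ [] ≈ᴹ (t , x) ∷ []
    singleton-cong {x = x} s≈t .at y with y ≟ᴬ x
    ... | yes _ = R.+-congʳ s≈t
    ... | no  _ = R.refl

    pair-cancel : ∀ {s t x} → s ⊕ t ≈ 0# → (s , x) ∷ (t , x) ∷ [] ≈ᴹ []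
    pair-cancel {x = x} s+t≈0 .at y with y ≟ᴬ x in eq
    ... | yes _ rewrite eq = R.trans (R.sym (R.+-assoc _ _ _)) (R.trans (R.+-identityʳ _) s+t≈0)
    ... | no  _ rewrite eq = R.refl

    concatMap-cancel : ∀ {i} {I : Set i} {f g : I → FormalSum A} → (∀ i → f i ++ g i ≈ᴹ []) →
                       ∀ is → concatMap f is ++ concatMap g is ≈ᴹ []
    concatMap-cancel f+g≈0 [] = ≈ᴹ-refl
    concatMap-cancel {f = f} {g} f+g≈0 (i ∷ is) = begin
      (f i ++ concatMap f is) ++ (g i ++ concatMap g is) ≈⟨ interchange (f i) _ (g i) _ ⟩
      (f i ++ g i) ++ (concatMap f is ++ concatMap g is) ≈⟨ +ᴹ-cong (f+g≈0 i) (concatMap-cancel f+g≈0 is) ⟩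
      [] ∎

    -- Removing a basis element from a null sum leaves a shorter null sum; this is the
    -- induction showing that extend respects _≋_.
    erase : A → FormalSum A → FormalSum A
    erase x = filter λ (_ , y) → ¬? (x ≟ᴬ y)

    coefficient-erase-≡ : ∀ x u → coefficient _≟ᴬ_ x (erase x u) ≈ 0#
    coefficient-erase-≡ x []            = R.refl
    coefficient-erase-≡ x ((s , y) ∷ u) with x ≟ᴬ y in eq
    ... | yes _ = coefficient-erase-≡ x u
    ... | no  _ rewrite eq = coefficient-erase-≡ x u

    coefficient-erase-≢ : ∀ {x y} → x ≢ y → ∀ u → coefficient _≟ᴬ_ x (erase y u) ≈ coefficient _≟ᴬ_ x u
    coefficient-erase-≢ x≢y [] = R.refl
    coefficient-erase-≢ {x} {y} x≢y ((s , z) ∷ u) with y ≟ᴬ z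
    ... | yes refl with x ≟ᴬ z
    ...   | yes x≡z = contradiction x≡z x≢y
    ...   | no  _   = coefficient-erase-≢ x≢y u
    coefficient-erase-≢ {x} {y} x≢y ((s , z) ∷ u) | no _ with x ≟ᴬ z
    ...   | yes _ = R.+-congˡ (coefficient-erase-≢ x≢y u)
    ...   | no  _ = coefficient-erase-≢ x≢y u

    erase-≋[] : ∀ x {u} → u ≈ᴹ [] → erase x u ≈ᴹ []
    erase-≋[] x {u} u≈0 .at y with y ≟ᴬ x
    ... | yes refl = coefficient-erase-≡ x u
    ... | no  y≢x  = R.trans (coefficient-erase-≢ y≢x u) (at u≈0 y)

  module _ {a b} {A : Set a} {B : Set b} (_≟ᴬ_ : DecidableEquality A) (_≟ᴮ_ : DecidableEquality B)
           (f : A → FormalSum B) where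
    private module A = Module (freeModule _≟ᴬ_)
    open Module (freeModule _≟ᴮ_)
    open SetoidReasoning ≈ᴹ-setoid
    open CommutativeSemigroupProperties
      (CommutativeMonoid.commutativeSemigroup +ᴹ-commutativeMonoid) using (x∙yz≈y∙xz)

    -- Gathers all occurrences of `x` into one term carrying its total coefficient, which is zero in
    -- a null sum.
    extend-erase : ∀ x u → extend f u ≈ᴹ scale (coefficient _≟ᴬ_ x u) (f x) ++ extend f (erase _≟ᴬ_ x u)
    extend-erase x []            = ≈ᴹ-sym (≈ᴹ-trans (+ᴹ-identityʳ _) (*ₗ-zeroˡ (f x)))
    extend-erase x ((s , y) ∷ u) with x ≟ᴬ y
    ... | yes refl = begin
      scale s (f x) ++ extend f u
        ≈⟨ +ᴹ-congˡ (extend-erase x u) ⟩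
      scale s (f x) ++ (scale (coefficient _≟ᴬ_ x u) (f x) ++ extend f (erase _≟ᴬ_ x u))
        ≈⟨ +ᴹ-assoc (scale s (f x)) _ _ ⟨
      (scale s (f x) ++ scale (coefficient _≟ᴬ_ x u) (f x)) ++ extend f (erase _≟ᴬ_ x u)
        ≈⟨ +ᴹ-congʳ (*ₗ-distribʳ (f x) s _) ⟨
      scale (s ⊕ coefficient _≟ᴬ_ x u) (f x) ++ extend f (erase _≟ᴬ_ x u) ∎
    ... | no _ = begin
      scale s (f y) ++ extend f u
        ≈⟨ +ᴹ-congˡ (extend-erase x u) ⟩
      scale s (f y) ++ (scale (coefficient _≟ᴬ_ x u) (f x) ++ extend f (erase _≟ᴬ_ x u))
        ≈⟨ x∙yz≈y∙xz (scale s (f y)) (scale (coefficient _≟ᴬ_ x u) (f x)) _ ⟩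
      scale (coefficient _≟ᴬ_ x u) (f x) ++ (scale s (f y) ++ extend f (erase _≟ᴬ_ x u)) ∎

    -- A null sum need not be the empty list, so the induction is on a length bound: erasing the
    -- head's basis element changes nothing up to `≈ᴹ` and shortens the list.
    extend-≋[] : ∀ {u} → u A.≈ᴹ [] → extend f u ≈ᴹ []
    extend-≋[] = go _ ≤-refl
      where
      go : ∀ m {u} → length u ≤ m → u A.≈ᴹ [] → extend f u ≈ᴹ []
      go _       {[]}          _         _   = ≈ᴹ-refl
      go (suc m) {(s , x) ∷ u} (s≤s u≤m) u≈0 = begin
        extend f ((s , x) ∷ u)
          ≈⟨ extend-erase x ((s , x) ∷ u) ⟩
        scale (coefficient _≟ᴬ_ x ((s , x) ∷ u)) (f x) ++ extend f (erase _≟ᴬ_ x ((s , x) ∷ u))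
          ≈⟨ +ᴹ-cong (≈ᴹ-trans (*ₗ-cong (at u≈0 x) ≈ᴹ-refl) (*ₗ-zeroˡ (f x)))
                     (go m shorter (erase-≋[] _≟ᴬ_ x u≈0)) ⟩
        [] ∎
        where
        shorter : length (erase _≟ᴬ_ x ((s , x) ∷ u)) ≤ m
        shorter with x ≟ᴬ x
        ... | yes _   = ≤-trans (length-filter _ u) u≤m
        ... | no  x≢x = contradiction refl x≢x

  module _ {a b d} {A : Set a} {B : Set b} {C : Set d} (_≟ᴬ_ : DecidableEquality A) where
    open Module (freeModule _≟ᴬ_)
    open SetoidReasoning ≈ᴹ-setoid
    open CommutativeSemigroupProperties
      (CommutativeMonoid.commutativeSemigroup +ᴹ-commutativeMonoid) using (interchange)

    -- Reduces the homotopy identity to basis elements; `B`, `A`, `C` stand for the bases in three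
    -- consecutive degrees, from high to low.
    extend-homotopy : {∂ᴮ : B → FormalSum A} {hᴬ : A → FormalSum B}
                      {∂ᴬ : A → FormalSum C} {hᶜ : C → FormalSum A} →
                      (∀ x → extend ∂ᴮ (hᴬ x) ++ extend hᶜ (∂ᴬ x) ≈ᴹ (1# , x) ∷ []) →
                      ∀ u → extend ∂ᴮ (extend hᴬ u) ++ extend hᶜ (extend ∂ᴬ u) ≈ᴹ u
    extend-homotopy eq []            = ≈ᴹ-refl
    extend-homotopy {∂ᴮ} {hᴬ} {∂ᴬ} {hᶜ} eq ((s , x) ∷ u) = begin
      extend ∂ᴮ (scale s (hᴬ x) ++ extend hᴬ u) ++ extend hᶜ (scale s (∂ᴬ x) ++ extend ∂ᴬ u)
        ≈⟨ +ᴹ-cong (linear ∂ᴮ (hᴬ x) _) (linear hᶜ (∂ᴬ x) _) ⟩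
      (scale s (extend ∂ᴮ (hᴬ x)) ++ extend ∂ᴮ (extend hᴬ u)) ++
      (scale s (extend hᶜ (∂ᴬ x)) ++ extend hᶜ (extend ∂ᴬ u))
        ≈⟨ interchange (scale s (extend ∂ᴮ (hᴬ x))) _ (scale s (extend hᶜ (∂ᴬ x))) _ ⟩
      (scale s (extend ∂ᴮ (hᴬ x)) ++ scale s (extend hᶜ (∂ᴬ x))) ++
      (extend ∂ᴮ (extend hᴬ u) ++ extend hᶜ (extend ∂ᴬ u))
        ≈⟨ +ᴹ-cong (≈ᴹ-sym (*ₗ-distribˡ s (extend ∂ᴮ (hᴬ x)) _)) (extend-homotopy eq u) ⟩
      scale s (extend ∂ᴮ (hᴬ x) ++ extend hᶜ (∂ᴬ x)) ++ u
        ≈⟨ +ᴹ-congʳ (*ₗ-cong R.refl (eq x)) ⟩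
      (s * 1# , x) ∷ u
        ≈⟨ +ᴹ-congʳ (singleton-cong _≟ᴬ_ (R.*-identityʳ s)) ⟩
      (s , x) ∷ u ∎
      where
      linear : ∀ {e} {E : Set e} (f : E → FormalSum A) v w →
               extend f (scale s v ++ w) ≈ᴹ scale s (extend f v) ++ extend f w
      linear f v w = ≈ᴹ-trans (extend-++ _≟ᴬ_ f (scale s v) w) (+ᴹ-congʳ (extend-scale _≟ᴬ_ f s v))

-- The contracting homotopy

module Contraction {c r} (R : CommutativeRing c r) {n} {D : Digraph n} (T : IsDirectedTree D) where
  open Digraph D
  open CommutativeRing R using (_≈_; 0#; 1#; -_; _*_; semiring) renaming (_+_ to _⊕_)
  private module R = CommutativeRing R
  open RingProperties R.ring using (-1*x≈-x)
  open Exp semiring using (_^_)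
  open FreeModule R
  open FormalSums R

  -- The first step v from x₀ towards x₁ is found by search; it depends only on x₀ and xₖ.
  insert : ∀ {k ℓ} → Generator D k ℓ → FormalSum (Generator D (suc k) ℓ)
  -- A default value: `allFin 0` is empty, so the boundary of a basis element of degree one is
  -- already `[]`.
  insert {zero}  _ = []
  insert {suc _} {ℓ} (x ∷ xs , p)
    with any? (λ v → (x ⟶? v) ×-dec ¬? (v ≟ᶠ Vec.head xs) ×-dec hasLength? D (x ∷ v ∷ xs) ℓ)
  ... | no  _ = []
  ... | yes (v , e , v≢ , len) =
    (- 1# , x ∷ v ∷ xs , Irrelevant.map (λ (uniq , _) → Unique-insert T e v≢ len uniq , len) p) ∷ []

  -- That the longer tuple is a generator makes `v` a valid search result. Any other result `w` also
  -- starts a path to the head of `xs`, hence equals `v`.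
  insert-new : ∀ {k ℓ x v} {xs : Vec (Fin n) (suc k)} p p′ → x ⟶ v →
               insert {suc k} {ℓ} (x ∷ xs , p) ≡ (- 1# , x ∷ v ∷ xs , p′) ∷ []
  insert-new {ℓ = ℓ} {x} {v} {xs@(_ ∷ _)} [ p ] [ p′ ] e
    with any? (λ v → (x ⟶? v) ×-dec ¬? (v ≟ᶠ Vec.head xs) ×-dec hasLength? D (x ∷ v ∷ xs) ℓ)
       -- The length proof in a generator is irrelevant; decidability recovers a usable one, from
       -- which paths can be read off.
       | recompute (hasLength? D (x ∷ v ∷ xs) ℓ) (proj₂ p′)
  ... | yes (w , f , _ , len) | len′
    with refl ← successor-unique T f (proj₂ (second-path len)) e (proj₂ (second-path len′)) = refl
  ... | no none | len =
    contradiction (v , e , (λ v≡ → ⊥-elim-irr (v≢ (proj₁ p′) v≡)) , len) none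
    where
    v≢ : ∀ {x v y} {ys : Vec (Fin n) _} → Unique (x ∷ v ∷ y ∷ ys) → v ≢ y
    v≢ (_ ∷ (v≢y ∷ _) ∷ _) = v≢y

  -- A search result would be a second successor of `x` leading to `y`.
  insert-adjacent : ∀ {k ℓ x y} {ys : Vec (Fin n) k} p → x ⟶ y →
                    insert {suc k} {ℓ} (x ∷ y ∷ ys , p) ≡ []
  insert-adjacent {ℓ = ℓ} {x} {y} {ys} p e
    with any? (λ v → (x ⟶? v) ×-dec ¬? (v ≟ᶠ y) ×-dec hasLength? D (x ∷ v ∷ y ∷ ys) ℓ)
  ... | yes (w , f , w≢y , len) =
    contradiction (successor-unique T f (proj₂ (second-path len)) e []) w≢y
  ... | no  _ = refl

  -- Removes the case distinction from the differential: the length test always succeeds.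
  delete-face : ∀ {k ℓ} i (g : Generator D (suc k) ℓ) → delete R D i g ≡ (1# , face T i g) ∷ []
  delete-face {ℓ = ℓ} i (xs , [ p ]) with hasLength? D (removeAt xs (suc (inject₁ i))) ℓ
  ... | yes _   = refl
  ... | no  ¬len = ⊥-elim-irr (¬len (HasLength-removeAt T (proj₂ p) i))

  sign : ∀ {k} → Fin k → R.Carrier
  sign i = (- 1#) ^ suc (toℕ (inject₁ i))

  term : ∀ {k ℓ} → Generator D (suc k) ℓ → Fin k → FormalSum (Generator D k ℓ)
  term g i = scale (sign i) (delete R D i g)

  boundary : ∀ {k ℓ} → Generator D (suc k) ℓ → FormalSum (Generator D k ℓ)
  boundary g = concatMap (term g) (allFin _)

  -- With `s` the sign of face `i`, the left summand is the coefficient of face `i + 1` after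
  -- inserting, the right one that of inserting into face `i`. Each factor `1#` comes from `delete`.
  signs-cancel : ∀ s → - 1# * (- 1# * s * 1#) ⊕ s * 1# * - 1# ≈ 0#
  signs-cancel s = begin
    - 1# * (- 1# * s * 1#) ⊕ s * 1# * - 1#
      ≈⟨ R.+-cong (R.*-congˡ (R.*-identityʳ _)) (R.*-congʳ (R.*-identityʳ s)) ⟩
    - 1# * (- 1# * s) ⊕ s * - 1#
      ≈⟨ R.+-cong (-1*x≈-x _) (R.*-comm s _) ⟩
    - (- 1# * s) ⊕ - 1# * s
      ≈⟨ R.-‿inverseˡ _ ⟩
    0# ∎
    where open SetoidReasoning R.setoid

  module _ {k ℓ : ℕ} where
    open Module (EMC R D (suc k) ℓ)
    open SetoidReasoning ≈ᴹ-setoid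
    private
      _≟_ = _≟ᵍ_ {k = suc k} {ℓ = ℓ} {D = D}

    -- Inserting `v` commutes with deleting a vertex after it, since the first step from `x` towards
    -- the last vertex is unaffected; the index shift by one flips the sign.
    term-cancel : ∀ {x v y} {ys : Vec (Fin n) k} p p′ → x ⟶ v → ∀ i →
                  scale (- 1#) (term (x ∷ v ∷ y ∷ ys , p′) (suc i)) ++
                  extend insert (term (x ∷ y ∷ ys , p) i) ≈ᴹ []
    term-cancel {x} {v} {y} {ys@(_ ∷ _)} p p′ e i
      rewrite delete-face (suc i) (x ∷ v ∷ y ∷ ys , p′)
            | delete-face i (x ∷ y ∷ ys , p)
            | insert-new {xs = removeAt (y ∷ ys) (inject₁ i)}
                (proof (face T i (x ∷ y ∷ ys , p)))
                (proof (face T (suc i) (x ∷ v ∷ y ∷ ys , p′))) e =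
      pair-cancel _≟_ (signs-cancel (sign i))

    -- Deleting the inserted `v` returns `g`, with the two signs cancelling; the other faces cancel
    -- by `term-cancel`.
    homotopy-new : ∀ {x v y} {ys : Vec (Fin n) k} p p′ → x ⟶ v →
                   let g = x ∷ y ∷ ys , p in
                   extend boundary (insert g) ++ extend insert (boundary g) ≈ᴹ (1# , g) ∷ []
    homotopy-new {x} {v} {y} {ys} p p′ e = begin
      extend boundary (insert g) ++ extend insert (boundary g)
        ≡⟨ cong₂ _++_ (cong (extend boundary) (insert-new p p′ e))
                      (extend-concatMap insert (term g) (allFin k)) ⟩
      (scale (- 1#) (boundary g′) ++ []) ++ S
        ≡⟨ cong (_++ S) (trans (++-identityʳ _)
             (cong (scale (- 1#)) (concatMap-allFin-suc k (term g′)))) ⟩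
      scale (- 1#) (term g′ zero ++ concatMap (term g′ ∘ suc) (allFin k)) ++ S
        ≈⟨ +ᴹ-congʳ (*ₗ-distribˡ (- 1#) (term g′ zero) _) ⟩
      (scale (- 1#) (term g′ zero) ++ scale (- 1#) (concatMap (term g′ ∘ suc) (allFin k))) ++ S
        ≡⟨ ++-assoc (scale (- 1#) (term g′ zero)) _ S ⟩
      scale (- 1#) (term g′ zero) ++ (scale (- 1#) (concatMap (term g′ ∘ suc) (allFin k)) ++ S)
        ≡⟨ cong (λ u → scale (- 1#) (term g′ zero) ++ (u ++ S))
                (map-concatMap _ (term g′ ∘ suc) (allFin k)) ⟩
      scale (- 1#) (term g′ zero) ++ (concatMap (scale (- 1#) ∘ term g′ ∘ suc) (allFin k) ++ S)
        ≈⟨ +ᴹ-cong first (concatMap-cancel _≟_ (term-cancel p p′ e) (allFin k)) ⟩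
      (1# , g) ∷ [] ∎
      where
      g : Generator D (suc k) ℓ
      g = x ∷ y ∷ ys , p

      g′ : Generator D (suc (suc k)) ℓ
      g′ = x ∷ v ∷ y ∷ ys , p′

      S : FormalSum (Generator D (suc k) ℓ)
      S = concatMap (extend insert ∘ term g) (allFin k)

      first : scale (- 1#) (term g′ zero) ≈ᴹ (1# , g) ∷ []
      first rewrite delete-face zero g′ = singleton-cong _≟_
        (R.trans (R.*-congˡ (R.trans (R.*-identityʳ _) (R.*-identityʳ _))) -1*-1≈1)

  module _ {k ℓ : ℕ} where
    open Module (EMC R D (suc (suc k)) ℓ)
    open SetoidReasoning ≈ᴹ-setoid

    -- Here `insert g` is zero. The entry `z` makes `y` interior: deleting `y` and reinserting it
    -- gives `g`, while every other face still begins with `x ⟶ y` and is killed.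
    homotopy-adjacent : ∀ {x y z} {zs : Vec (Fin n) k} p → x ⟶ y →
                        let g = x ∷ y ∷ z ∷ zs , p in
                        extend boundary (insert g) ++ extend insert (boundary g) ≈ᴹ (1# , g) ∷ []
    homotopy-adjacent {x} {y} {z} {zs} p e = begin
      extend boundary (insert g) ++ extend insert (boundary g)
        ≡⟨ cong₂ _++_ (cong (extend boundary) (insert-adjacent p e))
                      (trans (extend-concatMap insert (term g) (allFin (suc k)))
                             (concatMap-allFin-suc k (extend insert ∘ term g))) ⟩
      extend insert (term g zero) ++ concatMap (extend insert ∘ term g ∘ suc) (allFin k)
        ≡⟨ cong (extend insert (term g zero) ++_) (concatMap-[] rest (allFin k)) ⟩
      extend insert (term g zero) ++ []
        ≈⟨ +ᴹ-congʳ first ⟩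
      (1# , g) ∷ [] ∎
      where
      g : Generator D (suc (suc k)) ℓ
      g = x ∷ y ∷ z ∷ zs , p

      first : extend insert (term g zero) ≈ᴹ (1# , g) ∷ []
      first rewrite delete-face zero g | insert-new (proof (face T zero g)) p e =
        singleton-cong _≟ᵍ_
          (R.trans (R.*-congʳ (R.trans (R.*-identityʳ _) (R.*-identityʳ _))) -1*-1≈1)

      rest : ∀ i → extend insert (term g (suc i)) ≡ []
      rest i rewrite delete-face (suc i) g
                   | insert-adjacent {ys = removeAt (z ∷ zs) (inject₁ i)}
                       (proof (face T (suc i) g)) e = refl

  homotopy : ∀ {k ℓ} → suc k ≢ ℓ → (g : Generator D (suc k) ℓ) →
             let open Module (EMC R D (suc k) ℓ) in
             extend boundary (insert g) ++ extend insert (boundary g) ≈ᴹ (1# , g) ∷ []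
  homotopy {ℓ = ℓ} k≢ℓ (xs@(x ∷ y ∷ _) , [ p ]) with recompute (hasLength? D xs ℓ) (proj₂ p)
  ... | ([] , _) ∷ _ = ⊥-elim-irr (x≢x (proj₁ p))
    where
    x≢x : ∀ {x} {xs : Vec (Fin n) _} → ¬ Unique (x ∷ x ∷ xs)
    x≢x ((x≢x ∷ _) ∷ _) = x≢x refl
  -- A lone edge has degree and length one, the diagonal case.
  ... | (e ∷ [] , _) ∷ [-]       = contradiction refl k≢ℓ
  ... | (e ∷ [] , _) ∷ (_ ∷ _)   = homotopy-adjacent [ p ] e
  ... | (e ∷ f ∷ q , _) ∷ len    = homotopy-new [ p ] [ Unique-insert T e v≢y len′ (proj₁ p) , len′ ] e
    where
    v≢y = λ where refl → no-closed-path T f q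
    -- Splitting the path after its first arrow leaves the total length definitionally unchanged.
    len′ = Path⇒Distance T (e ∷ []) ∷ Path⇒Distance T (f ∷ q) ∷ len

  vanishes : ∀ k ℓ → k ≢ ℓ → EMH-vanishes R D k ℓ
  vanishes zero    ℓ k≢ℓ ([] , _) = [] , ≈ᴹ-refl
    where open Module (EMC R D 0 ℓ)
  -- A one-vertex tuple has length zero, so off the diagonal there are no generators in degree zero.
  vanishes zero    ℓ k≢ℓ ((_ , x ∷ [] , [ p ]) ∷ _ , _) = ⊥-elim-irr (length-zero (proj₂ p))
    where
    length-zero : ¬ HasLength D (x ∷ []) ℓ
    length-zero [-] = k≢ℓ refl
  vanishes (suc k) ℓ k≢ℓ (z , ∂z≈0) = extend insert z , (begin
    extend boundary (extend insert z)
      ≈⟨ +ᴹ-identityʳ _ ⟨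
    extend boundary (extend insert z) ++ []
      ≈⟨ +ᴹ-congˡ (extend-≋[] _≟ᵍ_ _≟ᵍ_ insert ∂z≈0) ⟨
    extend boundary (extend insert z) ++ extend insert (extend boundary z)
      ≈⟨ extend-homotopy _≟ᵍ_ (homotopy k≢ℓ) z ⟩
    z
      -- The zero class is represented by `[]`, whose negative is again `[]`, so the difference to
      -- be bounded is `z ++ []`.
      ≈⟨ +ᴹ-identityʳ z ⟨
    z ++ [] ∎)
    where
    open Module (EMC R D (suc k) ℓ)
    open SetoidReasoning ≈ᴹ-setoid

proposition3p4 : ∀ {c r} (R : CommutativeRing c r) {n : ℕ} (T : Digraph n) →
    IsDirectedTree T → RegularlyDiagonal R T
proposition3p4 R T tree = Contraction.vanishes R tree
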